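{- Let $G$ be a finite simple graph. If the complement $\overline{G}$ is triangle-free and $\operatorname{diam}(\overline{G})=3$, then $pc_{1,2}(G)\leq 3$.
   Context: All graphs are finite, undirected and simple. An edge-coloring is an arbitrary map from the edge set to a set of colors (adjacent edges may receive the same color). In an edge-colored graph, a path $P$ is a distance $2$-proper path if no two edges of $P$ of the same color appear with fewer than $2$ edges in between on $P$; equivalently, any two distinct edges of $P$ that are consecutive on $P$ or separated by exactly one edge of $P$ have different colors. The $(1,2)$-proper connection number $pc_{1,2}(G)$ is the minimum number of colors in an edge-coloring of $G$ such that every two distinct vertices of $G$ are joined by a distance $2$-proper path in $G$. The inequality $pc_{1,2}(G)\leq 3$ means that such a coloring with at most $3$ colors exists (in particular that $G$ is connected). The condition $\operatorname{diam}(\overline{G})=3$ includes that $\overline{G}$ is connected. -}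

module Defs where

open import Data.Fin.Base using (Fin; toℕ)
open import Data.Fin.Properties using () renaming (_≟_ to _≟ᶠ_)
open import Data.List.Base using (List; []; _∷_; length; lookup)
open import Data.List.Relation.Unary.Unique.Propositional using (Unique)
open import Data.Nat.Base using (ℕ; zero; suc; _∸_; _≤_; _<_)
open import Data.Product.Base using (Σ-syntax; ∃-syntax; _×_; _,_)
open import Level using (0ℓ)
open import Relation.Binary.Core using (Rel)
open import Relation.Binary.Definitions using (Symmetric; Irreflexive; Decidable)
open import Relation.Binary.PropositionalEquality using (_≡_; _≢_; ≢-sym)
open import Relation.Nullary.Decidable using (¬?; _×-dec_)
open import Relation.Nullary.Negation using (¬_)

record Graph (n : ℕ) : Set₁ where
  field
    Adj    : Rel (Fin n) 0ℓ
    adj?   : Decidable Adj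
    sym    : Symmetric Adj
    irrefl : Irreflexive _≡_ Adj

open Graph public

complement : ∀ {n} → Graph n → Graph n
complement G .Adj u v           = u ≢ v × ¬ Adj G u v
complement G .adj? u v          = ¬? (u ≟ᶠ v) ×-dec ¬? (adj? G u v)
complement G .sym (u≢v , ¬uv)   = ≢-sym u≢v , λ vu → ¬uv (sym G vu)
complement G .irrefl u≡v (u≢v , _) = u≢v u≡v

TriangleFree : ∀ {n} → Graph n → Set
TriangleFree G = ∀ u v w → ¬ (Adj G u v × Adj G v w × Adj G w u)

infixr 5 _∷_

data Walk {n : ℕ} (G : Graph n) : Fin n → Fin n → Set where
  []  : ∀ {u} → Walk G u u
  _∷_ : ∀ {u v w} → Adj G u v → Walk G v w → Walk G u w

module _ {n : ℕ} {G : Graph n} where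

  vertices : ∀ {u v} → Walk G u v → List (Fin n)
  vertices {u} []      = u ∷ []
  vertices {u} (e ∷ p) = u ∷ vertices p

  walkLength : ∀ {u v} → Walk G u v → ℕ
  walkLength []      = zero
  walkLength (e ∷ p) = suc (walkLength p)

  IsPath : ∀ {u v} → Walk G u v → Set
  IsPath p = Unique (vertices p)

IsDistance : ∀ {n} → Graph n → Fin n → Fin n → ℕ → Set
IsDistance G u v d =
  (Σ[ p ∈ Walk G u v ] IsPath p × walkLength p ≡ d) ×
  (∀ (p : Walk G u v) → IsPath p → d ≤ walkLength p)

-- Connectedness is part of the first component.
IsDiameter : ∀ {n} → Graph n → ℕ → Set
IsDiameter G d =
  (∀ u v → ∃[ e ] IsDistance G u v e × e ≤ d) ×
  (∃[ u ] ∃[ v ] IsDistance G u v d)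

-- A map from the set of undirected edges to k colors: it does not depend on
-- the proof of adjacency (irrelevant argument), nor on the orientation.
record EdgeColoring {n : ℕ} (G : Graph n) (k : ℕ) : Set where
  field
    color     : ∀ u v → .(Adj G u v) → Fin k
    color-sym : ∀ u v (e : Adj G u v) → color u v e ≡ color v u (sym G e)

open EdgeColoring public

module _ {n k : ℕ} {G : Graph n} (c : EdgeColoring G k) where

  colors : ∀ {u v} → Walk G u v → List (Fin k)
  colors []                = []
  colors (_∷_ {u} {v} e p) = color c u v e ∷ colors p

  -- The i-th and j-th edges, i < j, have j ∸ (i + 1) edges in between.
  Distance2Proper : ∀ {u v} → Walk G u v → Set
  Distance2Proper p =
    ∀ (i j : Fin (length (colors p))) →
    toℕ i < toℕ j → toℕ j ∸ suc (toℕ i) < 2 →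
    lookup (colors p) i ≢ lookup (colors p) j

  IsOneTwoProperConnected : Set
  IsOneTwoProperConnected =
    ∀ u v → u ≢ v → Σ[ p ∈ Walk G u v ] IsPath p × Distance2Proper p

-- The inequality pc₁,₂(G) ≤ m: the minimum defining pc₁,₂(G) is over a set of
-- color counts that contains some k ≤ m.
pc₁₂[_]≤_ : ∀ {n} → Graph n → ℕ → Set
pc₁₂[ G ]≤ m = ∃[ k ] k ≤ m × Σ[ c ∈ EdgeColoring G k ] IsOneTwoProperConnected c

{-# OPTIONS --safe #-}

-- Let H be the complement of G, let w and x be at H-distance 3, and let Nᵢ be
-- the set of vertices at H-distance i from x.  Colour the edges x–N₃ of G with
-- 0, all other edges that meet N₃ with 1, and the rest with 2.  Vertices in
-- layers that differ by at least 2 are adjacent in G, so the ends of every edge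
-- of H are joined by one of the following paths:
--   x ∈ N₀, u ∈ N₁ :  x w u            colours 0 1
--   v ∈ N₂, u ∈ N₁ :  v x w u          colours 2 0 1
--   v, v′ ∈ N₂     :  v x w u v′       colours 2 0 1 2,  u ∈ N₁ an H-neighbour of v
--   v ∈ N₂, y ∈ N₃ :  v x y            colours 2 0
--   y, y′ ∈ N₃     :  y x v y′         colours 0 2 1,    v ∈ N₂ an H-neighbour of y
-- where u v′ and v y′ are edges of G because H is triangle-free; for the same
-- reason N₁ contains no edge of H.

module Submission where

open import Defs
open import Data.Empty using (⊥-elim)
open import Data.Fin.Base using (Fin; toℕ)
open import Data.Fin.Patterns using (0F; 1F; 2F)
open import Data.Fin.Properties using (all?) renaming (_≟_ to _≟ᶠ_)
open import Data.List.Base using (List; []; _∷_; length; lookup)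
open import Data.List.Membership.DecPropositional using (_∈?_)
open import Data.List.Membership.Propositional using (_∈_)
open import Data.List.Relation.Unary.All using ([]; _∷_)
open import Data.List.Relation.Unary.All.Properties using (¬Any⇒All¬)
open import Data.List.Relation.Unary.AllPairs using ([]; _∷_)
open import Data.List.Relation.Unary.Any using (here; there)
open import Data.Nat.Base using (ℕ; suc; _∸_; _≤_; _<_; _⊓_; _⊔_; z≤n; s≤s; s≤s⁻¹; 2+)
open import Data.Nat.Properties
  using (≤-trans; ≤-refl; ≤-antisym; m≤n⇒m≤1+n; n≤0⇒n≡0; <⇒≱; <⇒≢; <-trans; n<1+n;
         _<?_; ⊓-comm; ⊔-comm)
open import Data.Product.Base using (Σ-syntax; ∃-syntax; _×_; _,_; proj₁; proj₂)
open import Relation.Binary.PropositionalEquality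
  using (_≡_; _≢_; refl; trans; cong₂; subst) renaming (sym to ≡-sym)
open import Relation.Nullary.Decidable
  using (Dec; yes; no; ¬?; _→-dec_; from-yes; decidable-stable)
open import Relation.Nullary.Negation using (¬_)

-- Distances measured by arbitrary walks.

module _ {n : ℕ} {H : Graph n} where

  suffix : ∀ {u v w} (p : Walk H v w) → IsPath p → u ∈ vertices p →
           Σ[ q ∈ Walk H u w ] IsPath q × walkLength q ≤ walkLength p
  suffix []      p-path       (here refl) = [] , p-path , z≤n
  suffix (e ∷ p) p-path       (here refl) = e ∷ p , p-path , ≤-refl
  suffix (e ∷ p) (_ ∷ p-path) (there u∈p) with suffix p p-path u∈p
  ... | q , q-path , q≤p = q , q-path , m≤n⇒m≤1+n q≤p

  -- Loop removal: when `u` already lies on the shortened tail, the suffix starting at `u` replaces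
  -- the whole walk.
  walk⇒path : ∀ {u v} (p : Walk H u v) →
              Σ[ q ∈ Walk H u v ] IsPath q × walkLength q ≤ walkLength p
  walk⇒path [] = [] , [] ∷ [] , z≤n
  walk⇒path {u} (e ∷ p) with walk⇒path p
  ... | q , q-path , q≤p with _∈?_ _≟ᶠ_ u (vertices q)
  ...   | no u∉q = e ∷ q , ¬Any⇒All¬ _ u∉q ∷ q-path , s≤s q≤p
  ...   | yes u∈q with suffix q q-path u∈q
  ...     | r , r-path , r≤q = r , r-path , m≤n⇒m≤1+n (≤-trans r≤q q≤p)

  -- With the bound extended from paths to walks, an edge can be prepended to a shortest path even
  -- if the result repeats a vertex.
  distance-minimal : ∀ {u v d} → IsDistance H u v d → (p : Walk H u v) → d ≤ walkLength p
  distance-minimal (_ , minimal) p with walk⇒path p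
  ... | q , q-path , q≤p = ≤-trans (minimal q q-path) q≤p

  distance-unique : ∀ {u v d e} → IsDistance H u v d → IsDistance H u v e → d ≡ e
  distance-unique D@((p , _ , refl) , _) E@((q , _ , refl) , _) =
    ≤-antisym (distance-minimal D q) (distance-minimal E p)

  distance-zero : ∀ {u v} → IsDistance H u v 0 → u ≡ v
  distance-zero (([] , _ , _) , _) = refl

  distance-adjacent : ∀ {u v w d e} → Adj H u v →
                      IsDistance H u w d → IsDistance H v w e → d ≤ suc e
  distance-adjacent uv D ((q , _ , refl) , _) = distance-minimal D (uv ∷ q)

  -- `v` is the second vertex of a shortest path: its tail gives `e ≤ d`, and prepending `uv` gives
  -- `suc d ≤ suc e`.
  distance-suc : ∀ {u w d} → IsDistance H u w (suc d) →
                 ∃[ v ] Adj H u v × ∀ {e} → IsDistance H v w e → e ≡ d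
  distance-suc D@((uv ∷ p , _ , refl) , _) =
    _ , uv , λ E → ≤-antisym (distance-minimal E p) (s≤s⁻¹ (distance-adjacent uv D E))

complement-nonadjacent : ∀ {n} (G : Graph n) {u v} →
                         u ≢ v → ¬ Adj (complement G) u v → Adj G u v
complement-nonadjacent G {u} {v} u≢v ¬uv =
  decidable-stable (adj? G u v) (λ ¬Guv → ¬uv (u≢v , ¬Guv))

-- The condition of `Distance2Proper` on a bare colour list, so that concrete lists are settled by
-- evaluating a decision procedure.
Proper₂ : ∀ {k} → List (Fin k) → Set
Proper₂ cs = ∀ (i j : Fin (length cs)) →
  toℕ i < toℕ j → toℕ j ∸ suc (toℕ i) < 2 → lookup cs i ≢ lookup cs j

proper₂? : ∀ {k} (cs : List (Fin k)) → Dec (Proper₂ cs)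
proper₂? cs = all? λ i → all? λ j →
  (toℕ i <? toℕ j) →-dec ((toℕ j ∸ suc (toℕ i) <? 2) →-dec ¬? (lookup cs i ≟ᶠ lookup cs j))

module Layers {n : ℕ} (G : Graph n) (triangle-free : TriangleFree (complement G))
  (x w : Fin n) (δ : Fin n → ℕ) (δ-distance : ∀ v → IsDistance (complement G) v x (δ v))
  (δ≤3 : ∀ v → δ v ≤ 3) (δw : δ w ≡ 3) where

  private
    H = complement G

  -- The layers of H around x, as the fibres of `δ`.

  δ-adjacent : ∀ {u v} → Adj H u v → δ u ≤ suc (δ v)
  δ-adjacent {u} {v} uv = distance-adjacent {H = H} uv (δ-distance u) (δ-distance v)

  δ-suc : ∀ {v d} → δ v ≡ suc d → ∃[ u ] Adj H v u × δ u ≡ d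
  δ-suc {v} δv with distance-suc {H = H} (subst (IsDistance H v x) δv (δ-distance v))
  ... | u , vu , δu = u , vu , δu (δ-distance u)

  δ-zero : ∀ {v} → δ v ≡ 0 → v ≡ x
  δ-zero {v} δv = distance-zero (subst (IsDistance H v x) δv (δ-distance v))

  δx : δ x ≡ 0
  δx = n≤0⇒n≡0 (distance-minimal (δ-distance x) [])

  δ-one : ∀ {v} → δ v ≡ 1 → Adj H v x
  δ-one {v} δv with δ-suc δv
  ... | u , vu , δu = subst (Adj H v) (δ-zero δu) vu

  separated : ∀ {u v a b} → δ u ≡ a → δ v ≡ b → a ≢ b → u ≢ v
  separated δu δv a≢b refl = a≢b (trans (≡-sym δu) δv)

  -- An edge of H changes `δ` by at most one.
  far-adjacent : ∀ {u v a b} → δ u ≡ a → δ v ≡ b → suc a < b → Adj G u v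
  far-adjacent refl refl far =
    complement-nonadjacent G (separated refl refl (<⇒≢ (<-trans (n<1+n _) far)))
      λ uv → <⇒≱ far (δ-adjacent (sym H uv))

  layers-02 : ∀ {u v} → δ u ≡ 0 → δ v ≡ 2 → Adj G u v
  layers-02 δu δv = far-adjacent δu δv ≤-refl

  layers-03 : ∀ {u v} → δ u ≡ 0 → δ v ≡ 3 → Adj G u v
  layers-03 δu δv = far-adjacent δu δv (s≤s (s≤s z≤n))

  layers-13 : ∀ {u v} → δ u ≡ 1 → δ v ≡ 3 → Adj G u v
  layers-13 δu δv = far-adjacent δu δv ≤-refl

  transfer : ∀ {u v v′} → Adj H v u → Adj H v v′ → u ≢ v′ → Adj G u v′
  transfer {u} {v} {v′} vu vv′ u≢v′ =
    complement-nonadjacent G u≢v′ λ uv′ → triangle-free v u v′ (vu , uv′ , sym H vv′)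

  -- The arguments are the smaller and the larger layer index of the ends. Sorting them makes the
  -- colour independent of orientation.
  sortedPalette : ℕ → ℕ → Fin 3
  sortedPalette 0 3 = 0F
  sortedPalette _ 3 = 1F
  sortedPalette _ _ = 2F

  palette : ℕ → ℕ → Fin 3
  palette a b = sortedPalette (a ⊓ b) (a ⊔ b)

  coloring : EdgeColoring G 3
  coloring .color u v _     = palette (δ u) (δ v)
  coloring .color-sym u v _ = cong₂ sortedPalette (⊓-comm (δ u) (δ v)) (⊔-comm (δ u) (δ v))

  ProperPath : Fin n → Fin n → Set
  ProperPath u v = Σ[ p ∈ Walk G u v ] IsPath p × Distance2Proper coloring p

  -- As `δ` is abstract, colours do not compute along a walk; the equation replaces them by a
  -- literal list that `proper₂?` can decide.
  path : ∀ {u v} (p : Walk G u v) → IsPath p →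
         {cs : List (Fin 3)} → colors coloring p ≡ cs → Proper₂ cs → ProperPath u v
  path p p-path refl proper = p , p-path , proper

  infixr 5 _&_
  _&_ : ∀ {c d : Fin 3} {cs ds : List (Fin 3)} → c ≡ d → cs ≡ ds → c ∷ cs ≡ d ∷ ds
  refl & refl = refl

  hue : ∀ {u v a b} → δ u ≡ a → δ v ≡ b → palette (δ u) (δ v) ≡ palette a b
  hue = cong₂ palette

  path-edge : ∀ {u v} → u ≢ v → Adj G u v → ProperPath u v
  path-edge u≢v uv = uv ∷ [] , (u≢v ∷ []) ∷ [] ∷ [] , proper
    where
    proper : Distance2Proper coloring (uv ∷ [])
    proper 0F 0F () _

  path-01 : ∀ {t u} → δ t ≡ 0 → δ u ≡ 1 → ProperPath t u
  path-01 δt δu = path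
    (layers-03 δt δw ∷ sym G (layers-13 δu δw) ∷ [])
    ((separated δt δw (λ ()) ∷ separated δt δu (λ ()) ∷ [])
      ∷ (separated δw δu (λ ()) ∷ []) ∷ [] ∷ [])
    (hue δt δw & hue δw δu & refl)
    (from-yes (proper₂? (0F ∷ 1F ∷ [])))

  path-10 : ∀ {u t} → δ u ≡ 1 → δ t ≡ 0 → ProperPath u t
  path-10 δu δt = path
    (layers-13 δu δw ∷ sym G (layers-03 δt δw) ∷ [])
    ((separated δu δw (λ ()) ∷ separated δu δt (λ ()) ∷ [])
      ∷ (separated δw δt (λ ()) ∷ []) ∷ [] ∷ [])
    (hue δu δw & hue δw δt & refl)
    (from-yes (proper₂? (1F ∷ 0F ∷ [])))

  path-12 : ∀ {u v} → δ u ≡ 1 → δ v ≡ 2 → ProperPath u v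
  path-12 δu δv = path
    (layers-13 δu δw ∷ sym G (layers-03 δx δw) ∷ layers-02 δx δv ∷ [])
    ((separated δu δw (λ ()) ∷ separated δu δx (λ ()) ∷ separated δu δv (λ ()) ∷ [])
      ∷ (separated δw δx (λ ()) ∷ separated δw δv (λ ()) ∷ [])
      ∷ (separated δx δv (λ ()) ∷ []) ∷ [] ∷ [])
    (hue δu δw & hue δw δx & hue δx δv & refl)
    (from-yes (proper₂? (1F ∷ 0F ∷ 2F ∷ [])))

  path-21 : ∀ {v u} → δ v ≡ 2 → δ u ≡ 1 → ProperPath v u
  path-21 δv δu = path
    (sym G (layers-02 δx δv) ∷ layers-03 δx δw ∷ sym G (layers-13 δu δw) ∷ [])
    ((separated δv δx (λ ()) ∷ separated δv δw (λ ()) ∷ separated δv δu (λ ()) ∷ [])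
      ∷ (separated δx δw (λ ()) ∷ separated δx δu (λ ()) ∷ [])
      ∷ (separated δw δu (λ ()) ∷ []) ∷ [] ∷ [])
    (hue δv δx & hue δx δw & hue δw δu & refl)
    (from-yes (proper₂? (2F ∷ 0F ∷ 1F ∷ [])))

  path-22 : ∀ {v v′} → Adj H v v′ → δ v ≡ 2 → δ v′ ≡ 2 → ProperPath v v′
  path-22 vv′ δv δv′ with δ-suc δv
  ... | u , vu , δu = path
    (sym G (layers-02 δx δv) ∷ layers-03 δx δw ∷ sym G (layers-13 δu δw)
      ∷ transfer vu vv′ (separated δu δv′ (λ ())) ∷ [])
    ((separated δv δx (λ ()) ∷ separated δv δw (λ ()) ∷ separated δv δu (λ ()) ∷ proj₁ vv′ ∷ [])
      ∷ (separated δx δw (λ ()) ∷ separated δx δu (λ ()) ∷ separated δx δv′ (λ ()) ∷ [])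
      ∷ (separated δw δu (λ ()) ∷ separated δw δv′ (λ ()) ∷ [])
      ∷ (separated δu δv′ (λ ()) ∷ []) ∷ [] ∷ [])
    (hue δv δx & hue δx δw & hue δw δu & hue δu δv′ & refl)
    (from-yes (proper₂? (2F ∷ 0F ∷ 1F ∷ 2F ∷ [])))

  path-23 : ∀ {v y} → δ v ≡ 2 → δ y ≡ 3 → ProperPath v y
  path-23 δv δy = path
    (sym G (layers-02 δx δv) ∷ layers-03 δx δy ∷ [])
    ((separated δv δx (λ ()) ∷ separated δv δy (λ ()) ∷ [])
      ∷ (separated δx δy (λ ()) ∷ []) ∷ [] ∷ [])
    (hue δv δx & hue δx δy & refl)
    (from-yes (proper₂? (2F ∷ 0F ∷ [])))

  path-32 : ∀ {y v} → δ y ≡ 3 → δ v ≡ 2 → ProperPath y v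
  path-32 δy δv = path
    (sym G (layers-03 δx δy) ∷ layers-02 δx δv ∷ [])
    ((separated δy δx (λ ()) ∷ separated δy δv (λ ()) ∷ [])
      ∷ (separated δx δv (λ ()) ∷ []) ∷ [] ∷ [])
    (hue δy δx & hue δx δv & refl)
    (from-yes (proper₂? (0F ∷ 2F ∷ [])))

  path-33 : ∀ {y y′} → Adj H y y′ → δ y ≡ 3 → δ y′ ≡ 3 → ProperPath y y′
  path-33 yy′ δy δy′ with δ-suc δy
  ... | v , yv , δv = path
    (sym G (layers-03 δx δy) ∷ layers-02 δx δv
      ∷ transfer yv yy′ (separated δv δy′ (λ ())) ∷ [])
    ((separated δy δx (λ ()) ∷ separated δy δv (λ ()) ∷ proj₁ yy′ ∷ [])
      ∷ (separated δx δv (λ ()) ∷ separated δx δy′ (λ ()) ∷ [])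
      ∷ (separated δv δy′ (λ ()) ∷ []) ∷ [] ∷ [])
    (hue δy δx & hue δx δv & hue δv δy′ & refl)
    (from-yes (proper₂? (0F ∷ 2F ∷ 1F ∷ [])))

  -- The layer indices are separate arguments so that they can be split on. Layers 0, 0 would force
  -- `u ≡ v`, and layers 1, 1 would give a triangle with `x`.
  path-H-edge : ∀ {u v} a b → Adj H u v → δ u ≡ a → δ v ≡ b →
                a ≤ 3 → b ≤ 3 → a ≤ suc b → b ≤ suc a → ProperPath u v
  path-H-edge 0 0 uv δu δv _ _ _ _ = ⊥-elim (proj₁ uv (trans (δ-zero δu) (≡-sym (δ-zero δv))))
  path-H-edge 0 1 uv δu δv _ _ _ _ = path-01 δu δv
  path-H-edge 1 0 uv δu δv _ _ _ _ = path-10 δu δv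
  path-H-edge {u} {v} 1 1 uv δu δv _ _ _ _ =
    ⊥-elim (triangle-free u v x (uv , δ-one δv , sym H (δ-one δu)))
  path-H-edge 1 2 uv δu δv _ _ _ _ = path-12 δu δv
  path-H-edge 2 1 uv δu δv _ _ _ _ = path-21 δu δv
  path-H-edge 2 2 uv δu δv _ _ _ _ = path-22 uv δu δv
  path-H-edge 2 3 uv δu δv _ _ _ _ = path-23 δu δv
  path-H-edge 3 2 uv δu δv _ _ _ _ = path-32 δu δv
  path-H-edge 3 3 uv δu δv _ _ _ _ = path-33 uv δu δv
  -- The remaining clauses are impossible: first layers at least two apart, then a layer beyond 3.
  path-H-edge 0 (2+ _) _ _ _ _ _ _ (s≤s ())
  path-H-edge (2+ _) 0 _ _ _ _ _ (s≤s ()) _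
  path-H-edge 1 (2+ (suc _)) _ _ _ _ _ _ (s≤s (s≤s ()))
  path-H-edge (2+ (suc _)) 1 _ _ _ _ _ (s≤s (s≤s ())) _
  path-H-edge (2+ (2+ _)) (2+ _) _ _ _ (s≤s (s≤s (s≤s ()))) _ _ _
  path-H-edge (2+ _) (2+ (2+ _)) _ _ _ _ (s≤s (s≤s (s≤s ()))) _ _

  connected : IsOneTwoProperConnected coloring
  connected u v u≢v with adj? G u v
  ... | yes uv = path-edge u≢v uv
  ... | no ¬uv = path-H-edge (δ u) (δ v) uv refl refl (δ≤3 u) (δ≤3 v)
                             (δ-adjacent uv) (δ-adjacent (sym H uv))
    where
    uv : Adj H u v
    uv = u≢v , ¬uv

theorem3p2 : ∀ (n : ℕ) (G : Graph n) → TriangleFree (complement G) → IsDiameter (complement G) 3 → pc₁₂[ G ]≤ 3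
theorem3p2 n G triangle-free (distance , w , x , wx) = 3 , ≤-refl , coloring , connected
  where
  open Layers G triangle-free x w
    (λ v → proj₁ (distance v x))
    (λ v → proj₁ (proj₂ (distance v x)))
    (λ v → proj₂ (proj₂ (distance v x)))
    -- The distance chosen by `distance w x` must agree with the 3 witnessed by `wx`.
    (distance-unique (proj₁ (proj₂ (distance w x))) wx)
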